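{- Let $\mathscr{Y}$ be a $\gamma$-line graph and let $\mathscr{G}$ be a root of $\Gamma(\mathscr{Y})$. If $\mathscr{G}$ is bipartite, then there exist exactly three mixed root orientations $\mathscr{X}$ (mixed orientations of $\mathscr{G}$) such that $L_\gamma(\mathscr{X})=\mathscr{Y}$; otherwise there exists exactly one such orientation.
   Context: $\gamma=e^{2\pi i/3}$. A mixed graph is obtained from a simple undirected graph by orienting some of its edges into arcs; the unoriented edges are called digons. $\Gamma(\mathscr{D})$ denotes the underlying undirected graph of a mixed graph $\mathscr{D}$; a mixed orientation of an undirected graph $\mathscr{G}$ is a mixed graph with underlying graph $\mathscr{G}$. $L(\mathscr{G})$ is the ordinary undirected line graph. An undirected graph $\mathscr{G}$ is a root of an undirected graph $H$ if $L(\mathscr{G})=H$. A $\gamma$-line graph is a mixed graph of the form $L_\gamma(\mathscr{X}_0)$ for some mixed graph $\mathscr{X}_0$. $\gamma$-line graph $L_\gamma(\mathscr{D})$: the mixed orientation of $L(\Gamma(\mathscr{D}))$ given as follows. For distinct edges $e,f$ of $\mathscr{D}$ sharing a vertex $v$: if $e$ is an arc with head $v$ and $f$ is an arc with tail $v$, there is an arc from $e$ to $f$; if $e,f$ are both arcs with head $v$, or both arcs with tail $v$, or both digons, then $ef$ is a digon; if $e$ is an arc with head $v$ and $f$ is a digon, there is an arc from $f$ to $e$; if $e$ is an arc with tail $v$ and $f$ is a digon, there is an arc from $e$ to $f$.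
   Formalization: The root graph is assumed connected with at least one edge; if it has four vertices, one adjacent to all others (K₁,₃, K₃ plus pendant edge, K₄ minus an edge, K₄), existence of a root orientation is assumed. Without these the statement fails, e.g. two disjoint edges give nine. -}

module Defs where

open import Data.Bool.Base using (Bool)
open import Data.Empty using (⊥-elim)
open import Data.Fin.Base using (Fin)
import Data.Fin.Base as Fin
import Data.Fin.Properties as Fin
open import Data.Nat.Base using (ℕ)
open import Data.Product.Base using (Σ; ∃; _×_; _,_; proj₁)
open import Data.Sum.Base using (_⊎_; inj₁; inj₂)
open import Function.Base using (_∘_)
open import Function.Bundles using (_⇔_; _↔_; Inverse)
open import Function.Properties.Equivalence using (⇔-isEquivalence)
open import Level using (Level; 0ℓ; _⊔_) renaming (suc to lsuc)
open import Relation.Binary.Bundles using (Setoid)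
open import Relation.Binary.Core using (Rel)
open import Relation.Binary.Definitions
  using (Asymmetric; Decidable; DecidableEquality; Irreflexive; Symmetric)
open import Relation.Binary.Construct.Closure.ReflexiveTransitive using (Star)
import Relation.Binary.Construct.On as On
open import Relation.Binary.PropositionalEquality.Core
  using (_≡_; _≢_; refl; subst; sym)
open import Relation.Binary.PropositionalEquality.Properties using (setoid)
open import Relation.Binary.Structures using (IsEquivalence)
open import Relation.Nullary.Decidable.Core
  using (Dec; yes; no; recompute; ¬?; _×-dec_; _⊎-dec_)
open import Relation.Nullary.Negation.Core using (¬_; contradiction)

record Graph (V : Set) : Set₁ where
  infix 4 _~_ _~?_
  field
    _~_      : Rel V 0ℓ
    ~-sym    : Symmetric _~_
    ~-irrefl : Irreflexive _≡_ _~_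
    _~?_     : Decidable _~_

-- A mixed graph with underlying graph G.  Adjacent vertices with no arc
-- between them are joined by a digon.

record Orientation {V : Set} (G : Graph V) : Set₁ where
  open Graph G
  field
    Arc      : Rel V 0ℓ
    Arc⇒~    : ∀ {u v} → Arc u v → u ~ v
    Arc-asym : Asymmetric Arc
    Arc?     : Decidable Arc

record MixedGraph (V : Set) : Set₁ where
  constructor mixed
  field
    {Γ}         : Graph V
    orientation : Orientation Γ
  open Orientation orientation public

open MixedGraph public using (Γ)

-- Orientations of one graph are compared by their arcs; the proofs they
-- carry are disregarded.

infix 4 _≋_

_≋_ : ∀ {V} {G : Graph V} → Rel (Orientation G) 0ℓ
X ≋ X′ = ∀ u v → Orientation.Arc X u v ⇔ Orientation.Arc X′ u v

≋-isEquivalence : ∀ {V} {G : Graph V} → IsEquivalence (_≋_ {G = G})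
≋-isEquivalence = record
  { refl  = λ u v → ⇔.refl
  ; sym   = λ p u v → ⇔.sym (p u v)
  ; trans = λ p q u v → ⇔.trans (p u v) (q u v)
  }
  where module ⇔ = IsEquivalence (⇔-isEquivalence {0ℓ})

record _≅_ {V W : Set} (G : Graph V) (H : Graph W) : Set where
  private
    module G = Graph G
    module H = Graph H
  field
    bijection : V ↔ W
  open Inverse bijection public using (to; from)
  field
    preserves : ∀ u v → u G.~ v ⇔ to u H.~ to v

infix 4 _≅_

-- Equality of mixed graphs once the vertices of their underlying graphs
-- are identified by φ.

PreservesArcs : ∀ {V W} (D : MixedGraph V) (D′ : MixedGraph W) →
                Γ D ≅ Γ D′ → Set
PreservesArcs D D′ φ = ∀ u v → D.Arc u v ⇔ D′.Arc (φ.to u) (φ.to v)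
  where
  module D  = MixedGraph D
  module D′ = MixedGraph D′
  module φ  = _≅_ φ

Connected : ∀ {V} → Graph V → Set
Connected G = ∀ u v → Star (Graph._~_ G) u v

Bipartite : ∀ {V} → Graph V → Set
Bipartite {V} G = ∃ λ (c : V → Bool) → ∀ u v → u ~ v → c u ≢ c v
  where open Graph G

-- An edge {u,v} is stored once, as the increasing pair.  Irrelevance makes
-- _≡_ on edges equality of the end pairs.

record Edge {n : ℕ} (G : Graph (Fin n)) : Set where
  constructor edge
  open Graph G
  field
    end₁ end₂  : Fin n
    .increasing : end₁ Fin.< end₂
    .adjacent   : end₁ ~ end₂

module _ {n : ℕ} {G : Graph (Fin n)} where

  open Graph G
  open Edge

  ordered : (e : Edge G) → end₁ e Fin.< end₂ e
  ordered (edge _ _ u<v _) = recompute (_ Fin.<? _) u<v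

  infix 4 _∈_ _∈?_ _≟ᵉ_

  _∈_ : Fin n → Edge G → Set
  v ∈ e = v ≡ end₁ e ⊎ v ≡ end₂ e

  _∈?_ : ∀ v e → Dec (v ∈ e)
  v ∈? e = (v Fin.≟ end₁ e) ⊎-dec (v Fin.≟ end₂ e)

  _≟ᵉ_ : DecidableEquality (Edge G)
  edge u v _ _ ≟ᵉ edge u′ v′ _ _ with u Fin.≟ u′ | v Fin.≟ v′
  ... | yes refl | yes refl = yes refl
  ... | no u≢u′  | _        = no λ { refl → u≢u′ refl }
  ... | yes _    | no v≢v′  = no λ { refl → v≢v′ refl }

  ShareVertex : Rel (Edge G) 0ℓ
  ShareVertex e f = ∃ λ v → v ∈ e × v ∈ f

  shareVertex-unique : ∀ e f {v w} → e ≢ f →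
                       v ∈ e → v ∈ f → w ∈ e → w ∈ f → v ≡ w
  shareVertex-unique e f _ (inj₁ refl) _ (inj₁ refl) _ = refl
  shareVertex-unique e f _ (inj₂ refl) _ (inj₂ refl) _ = refl
  shareVertex-unique e f _ _ (inj₁ refl) _ (inj₁ refl) = refl
  shareVertex-unique e f _ _ (inj₂ refl) _ (inj₂ refl) = refl
  shareVertex-unique (edge _ _ _ _) (edge _ _ _ _) e≢f
       (inj₁ refl) (inj₁ refl) (inj₂ refl) (inj₂ refl) = contradiction refl e≢f
  shareVertex-unique (edge _ _ _ _) (edge _ _ _ _) e≢f
       (inj₂ refl) (inj₂ refl) (inj₁ refl) (inj₁ refl) = contradiction refl e≢f
  shareVertex-unique e f _ (inj₁ refl) (inj₂ refl) (inj₂ refl) (inj₁ p) =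
      ⊥-elim (Fin.<-asym (ordered e) (subst (Fin._< end₂ f) (sym p) (ordered f)))
  shareVertex-unique e f _ (inj₂ refl) (inj₁ refl) (inj₁ refl) (inj₂ p) =
      ⊥-elim (Fin.<-asym (ordered e) (subst (end₁ f Fin.<_) (sym p) (ordered f)))

L : ∀ {n} (G : Graph (Fin n)) → Graph (Edge G)
L G = record
  { _~_      = λ e f → e ≢ f × ShareVertex e f
  ; ~-sym    = λ (e≢f , v , v∈e , v∈f) → e≢f ∘ sym , v , v∈f , v∈e
  ; ~-irrefl = λ e≡f (e≢f , _) → e≢f e≡f
  ; _~?_     = λ e f → ¬? (e ≟ᵉ f) ×-dec
                       Fin.any? (λ v → (v ∈? e) ×-dec (v ∈? f))
  }

module _ {n : ℕ} (D : MixedGraph (Fin n)) where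

  open MixedGraph D using (Arc; Arc?; Arc-asym)

  HasHead HasTail : Edge (Γ D) → Fin n → Set
  HasHead e v = ∃ λ u → u ∈ e × v ∈ e × Arc u v
  HasTail e v = ∃ λ u → u ∈ e × v ∈ e × Arc v u

  IsDigon : Edge (Γ D) → Set
  IsDigon e = ¬ Arc (Edge.end₁ e) (Edge.end₂ e) ×
              ¬ Arc (Edge.end₂ e) (Edge.end₁ e)

  data LArcAt (v : Fin n) (e f : Edge (Γ D)) : Set where
    head-tail  : HasHead e v → HasTail f v → LArcAt v e f
    digon-head : IsDigon e → HasHead f v → LArcAt v e f
    tail-digon : HasTail e v → IsDigon f → LArcAt v e f

  LArc : Rel (Edge (Γ D)) 0ℓ
  LArc e f = e ≢ f × ∃ λ v → v ∈ e × v ∈ f × LArcAt v e f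

  private
    Arc-irrefl : ∀ {v} → ¬ Arc v v
    Arc-irrefl a = Arc-asym a a

    head-not-tail : ∀ e {v} → HasHead e v → ¬ HasTail e v
    head-not-tail _ (u , inj₁ refl , inj₁ refl , a) _ = Arc-irrefl a
    head-not-tail _ (u , inj₂ refl , inj₂ refl , a) _ = Arc-irrefl a
    head-not-tail _ (u , inj₁ refl , inj₂ refl , a) (w , inj₁ refl , _ , b) = Arc-asym a b
    head-not-tail _ (u , inj₁ refl , inj₂ refl , a) (w , inj₂ refl , _ , b) = Arc-irrefl b
    head-not-tail _ (u , inj₂ refl , inj₁ refl , a) (w , inj₂ refl , _ , b) = Arc-asym a b
    head-not-tail _ (u , inj₂ refl , inj₁ refl , a) (w , inj₁ refl , _ , b) = Arc-irrefl b

    digon-no-arc : ∀ e {u v} → IsDigon e → u ∈ e → v ∈ e → ¬ Arc u v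
    digon-no-arc _ _ (inj₁ refl) (inj₁ refl) = Arc-irrefl
    digon-no-arc _ _ (inj₂ refl) (inj₂ refl) = Arc-irrefl
    digon-no-arc _ (p , _) (inj₁ refl) (inj₂ refl) = p
    digon-no-arc _ (_ , q) (inj₂ refl) (inj₁ refl) = q

    digon-no-head : ∀ e {v} → IsDigon e → ¬ HasHead e v
    digon-no-head e d (_ , u∈e , v∈e , a) = digon-no-arc e d u∈e v∈e a

    digon-no-tail : ∀ e {v} → IsDigon e → ¬ HasTail e v
    digon-no-tail e d (_ , u∈e , v∈e , a) = digon-no-arc e d v∈e u∈e a

    LArcAt-asym : ∀ {v} e f → LArcAt v e f → ¬ LArcAt v f e
    LArcAt-asym e f (head-tail h _)  (head-tail _ t)  = head-not-tail e h t
    LArcAt-asym e f (head-tail _ t)  (digon-head d _) = digon-no-tail f d t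
    LArcAt-asym e f (head-tail h _)  (tail-digon _ d) = digon-no-head e d h
    LArcAt-asym e f (digon-head d _) (head-tail _ t)  = digon-no-tail e d t
    LArcAt-asym e f (digon-head d _) (digon-head _ h) = digon-no-head e d h
    LArcAt-asym e f (digon-head _ h) (tail-digon t _) = head-not-tail f h t
    LArcAt-asym e f (tail-digon _ d) (head-tail h _)  = digon-no-head f d h
    LArcAt-asym e f (tail-digon t _) (digon-head _ h) = head-not-tail e h t
    LArcAt-asym e f (tail-digon _ d) (tail-digon t _) = digon-no-tail f d t

    LArc-asym : Asymmetric LArc
    LArc-asym {e} {f} (e≢f , v , v∈e , v∈f , a) (_ , w , w∈f , w∈e , b)
      with refl ← shareVertex-unique e f e≢f v∈e v∈f w∈e w∈f = LArcAt-asym e f a b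

    HasHead? : ∀ e v → Dec (HasHead e v)
    HasHead? e v = Fin.any? λ u → (u ∈? e) ×-dec (v ∈? e) ×-dec Arc? u v

    HasTail? : ∀ e v → Dec (HasTail e v)
    HasTail? e v = Fin.any? λ u → (u ∈? e) ×-dec (v ∈? e) ×-dec Arc? v u

    IsDigon? : ∀ e → Dec (IsDigon e)
    IsDigon? e = ¬? (Arc? _ _) ×-dec ¬? (Arc? _ _)

    LArcAt? : ∀ v e f → Dec (LArcAt v e f)
    LArcAt? v e f with HasHead? e v ×-dec HasTail? f v
                     | IsDigon? e ×-dec HasHead? f v
                     | HasTail? e v ×-dec IsDigon? f
    ... | yes (h , t) | _           | _           = yes (head-tail h t)
    ... | no _        | yes (d , h) | _           = yes (digon-head d h)
    ... | no _        | no _        | yes (t , d) = yes (tail-digon t d)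
    ... | no ¬ht      | no ¬dh      | no ¬td      = no λ where
      (head-tail h t)  → ¬ht (h , t)
      (digon-head d h) → ¬dh (d , h)
      (tail-digon t d) → ¬td (t , d)

    LArc? : Decidable LArc
    LArc? e f = ¬? (e ≟ᵉ f) ×-dec
      Fin.any? λ v → (v ∈? e) ×-dec (v ∈? f) ×-dec LArcAt? v e f

  -- Adjacent e and f that are both arcs with head v, both arcs with tail v
  -- or both digons get no arc, hence form a digon.

  Lγ : MixedGraph (Edge (Γ D))
  Lγ = mixed {Γ = L (Γ D)} record
    { Arc      = LArc
    ; Arc⇒~    = λ (e≢f , v , v∈e , v∈f , _) → e≢f , v , v∈e , v∈f
    ; Arc-asym = λ {e f} → LArc-asym {e} {f}
    ; Arc?     = LArc?
    }

IsγLineGraph : ∀ {W} → MixedGraph W → Set₁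
IsγLineGraph Y =
  ∃ λ m → Σ (MixedGraph (Fin m)) λ X₀ →
  Σ (L (Γ X₀) ≅ Γ Y) λ ψ → PreservesArcs (Lγ X₀) Y ψ

-- The identification of the edges of G with the vertices of H is part of
-- the data: root orientations are counted with respect to it.

Root : ∀ {n W} → Graph (Fin n) → Graph W → Set
Root G H = L G ≅ H

RootOrientation : ∀ {n W} {G : Graph (Fin n)} (Y : MixedGraph W) →
                  Root G (Γ Y) → Set₁
RootOrientation {G = G} Y φ =
  Σ (Orientation G) λ X → PreservesArcs (Lγ (mixed X)) Y φ

RootOrientations : ∀ {n W} {G : Graph (Fin n)} (Y : MixedGraph W) →
                   Root G (Γ Y) → Setoid (lsuc 0ℓ) 0ℓ
RootOrientations Y φ = record
  { Carrier       = RootOrientation Y φ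
  ; _≈_           = λ (X , _) (X′ , _) → X ≋ X′
  ; isEquivalence = On.isEquivalence proj₁ ≋-isEquivalence
  }

HasExactly : ∀ {c ℓ} → ℕ → Setoid c ℓ → Set (c ⊔ ℓ)
HasExactly k S = Inverse (setoid (Fin k)) S

-- For connected G these are K₁,₃, K₃ with a pendant edge, K₄ minus an edge
-- and K₄.  By Whitney's theorem an isomorphism L(G) ≅ L(G′) with G and G′
-- connected is induced by an isomorphism G ≅ G′ unless G is one of them or
-- G = K₃ and G′ = K₁,₃.  When G is one of the four, an identification of
-- L G with Γ Y may send a vertex star of G to a triangle of a graph X₀ with
-- Lγ X₀ = Y, and then Y can fail to have any root orientation on G.

WhitneyException : ∀ {n} → Graph (Fin n) → Set
WhitneyException {n} G = n ≡ 4 × ∃ λ v → ∀ w → w ≢ v → v ~ w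
  where open Graph G

{-# OPTIONS --safe #-}

-- Give an edge e the phase 1, -1 or 0 (mod 3) at its end v according as v is
-- the head of e, its tail, or e is a digon.  The phases of e at its two ends
-- are opposite, and Lγ has an arc from e to f at a common end v exactly when
-- the phase of f at v is one more than that of e.  Hence two root orientations
-- differ by a function on the vertices whose values at adjacent vertices are
-- opposite.  On a connected graph such a function is determined by one value;
-- it can be nonzero only if its sign is a 2-colouring, and then the value is
-- arbitrary.
--
-- For existence let θ identify the edges of G with those of a graph H that has
-- an orientation X₀ with Lγ X₀ = Y.  If θ sends every vertex star of G into a
-- star of H, then θ comes from a map of ends, along which X₀ is pulled back,
-- unless two adjacent stars go to the same star of H; in that case G is a
-- triangle, and the equations for the phases are solved directly.  A star of G
-- that is not sent into a star consists of three edges sent onto a triangle,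
-- and connectedness then leaves only the exceptional graphs on four vertices.

module Submission where

open import Defs
open import Data.Bool.Base using (Bool; true; false)
open import Data.Fin.Base using (Fin)
import Data.Fin.Base as Fin
import Data.Fin.Properties as Fin
open import Data.Fin.Patterns using (0F; 1F; 2F; 3F)
open import Data.Fin.Properties using (_≟_; any?; all?)
open import Data.Nat.Base using (ℕ)
open import Data.Product.Base using (Σ; ∃; _×_; _,_; proj₁; proj₂; swap)
open import Data.Sum.Base using (_⊎_; inj₁; inj₂)
open import Data.Vec.Base using (Vec; []; _∷_; lookup)
open import Data.Vec.Relation.Unary.All using ([]; _∷_)
open import Data.Vec.Relation.Unary.AllPairs using ([]; _∷_)
open import Data.Vec.Relation.Unary.Unique.Propositional using (Unique)
open import Data.Vec.Relation.Unary.Unique.Propositional.Properties using (lookup-injective)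
open import Function.Base using (_∘_)
open import Function.Bundles using (_⇔_; mk⇔; Equivalence; Inverse)
open import Function.Properties.Equivalence using (⇔-isEquivalence)
open import Level using (0ℓ)
open import Relation.Binary.Construct.Closure.ReflexiveTransitive using (Star; ε; _◅_)
open import Relation.Binary.Definitions using (tri<; tri≈; tri>)
open import Relation.Binary.PropositionalEquality
  using (_≡_; _≢_; refl; sym; trans; cong; cong₂; subst; subst₂; ≢-sym)
open import Relation.Binary.Structures using (IsEquivalence)
open import Relation.Nullary.Decidable
  using ( Dec; yes; no; does; does-⇔; map′; recompute; decidable-stable; from-yes
        ; ¬?; _×-dec_; _→-dec_ )
open import Relation.Nullary.Negation using (¬_; contradiction)

open Equivalence using (to; from)

private
  module ⇔ = IsEquivalence (⇔-isEquivalence {0ℓ})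

-- Arithmetic modulo 3

infixl 6 _⊕_ _⊖_
infix 8 ⊝_

_⊕_ : Fin 3 → Fin 3 → Fin 3
0F ⊕ j  = j
1F ⊕ 0F = 1F
1F ⊕ 1F = 2F
1F ⊕ 2F = 0F
2F ⊕ 0F = 2F
2F ⊕ 1F = 0F
2F ⊕ 2F = 1F

⊝_ : Fin 3 → Fin 3
⊝ 0F = 0F
⊝ 1F = 2F
⊝ 2F = 1F

_⊖_ : Fin 3 → Fin 3 → Fin 3
i ⊖ j = i ⊕ ⊝ j

⊝-involutive : ∀ i → ⊝ ⊝ i ≡ i
⊝-involutive = from-yes (all? λ i → ⊝ ⊝ i ≟ i)

⊝-⊖ : ∀ i j → i ⊖ j ≡ ⊝ (j ⊖ i)
⊝-⊖ = from-yes (all? λ i → all? λ j → i ⊖ j ≟ ⊝ (j ⊖ i))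

⊝-distrib-⊕ : ∀ i j → ⊝ i ⊕ ⊝ j ≡ ⊝ (i ⊕ j)
⊝-distrib-⊕ = from-yes (all? λ i → all? λ j → ⊝ i ⊕ ⊝ j ≟ ⊝ (i ⊕ j))

i⊕[j⊖i]≡j : ∀ i j → i ⊕ (j ⊖ i) ≡ j
i⊕[j⊖i]≡j = from-yes (all? λ i → all? λ j → i ⊕ (j ⊖ i) ≟ j)

[i⊕j]⊖i≡j : ∀ i j → (i ⊕ j) ⊖ i ≡ j
[i⊕j]⊖i≡j = from-yes (all? λ i → all? λ j → (i ⊕ j) ⊖ i ≟ j)

-- The relation that encodes an arc depends only on a difference, so adding the same amount to all
-- phases at a vertex preserves it.
suc-shift : ∀ i j k → i ≡ 1F ⊕ j ⇔ i ⊕ k ≡ 1F ⊕ (j ⊕ k)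
suc-shift i j k = mk⇔
  (from-yes (all? λ i → all? λ j → all? λ k →
     (i ≟ 1F ⊕ j) →-dec (i ⊕ k ≟ 1F ⊕ (j ⊕ k))) i j k)
  (from-yes (all? λ i → all? λ j → all? λ k →
     (i ⊕ k ≟ 1F ⊕ (j ⊕ k)) →-dec (i ≟ 1F ⊕ j)) i j k)

-- Reflection in `k` negates differences and so exchanges the roles of `i` and `j`. This serves the
-- triangle case, where the phases at a corner `x` have the form `T x` minus a phase at `q`.
suc-⊖ : ∀ i j k → i ≡ 1F ⊕ j ⇔ k ⊖ j ≡ 1F ⊕ (k ⊖ i)
suc-⊖ i j k = mk⇔
  (from-yes (all? λ i → all? λ j → all? λ k →
     (i ≟ 1F ⊕ j) →-dec (k ⊖ j ≟ 1F ⊕ (k ⊖ i))) i j k)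
  (from-yes (all? λ i → all? λ j → all? λ k →
     (k ⊖ j ≟ 1F ⊕ (k ⊖ i)) →-dec (i ≟ 1F ⊕ j)) i j k)

-- A difference modulo 3 is determined by whether it is 1 and whether it is -1.
⊖-determined : ∀ {i j i′ j′} →
  j ≡ 1F ⊕ i ⇔ j′ ≡ 1F ⊕ i′ → i ≡ 1F ⊕ j ⇔ i′ ≡ 1F ⊕ j′ →
  i′ ⊖ i ≡ j′ ⊖ j
⊖-determined {i} {j} {i′} {j′} p q =
  from-yes (all? λ i → all? λ j → all? λ i′ → all? λ j′ →
    ((j ≟ 1F ⊕ i) →-dec (j′ ≟ 1F ⊕ i′)) →-dec
    ((j′ ≟ 1F ⊕ i′) →-dec (j ≟ 1F ⊕ i)) →-dec
    ((i ≟ 1F ⊕ j) →-dec (i′ ≟ 1F ⊕ j′)) →-dec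
    ((i′ ≟ 1F ⊕ j′) →-dec (i ≟ 1F ⊕ j)) →-dec
    (i′ ⊖ i ≟ j′ ⊖ j))
  i j i′ j′ (to p) (from p) (to q) (from q)

⊖-transfer : ∀ i j i′ j′ → i ≡ i′ → i′ ⊖ i ≡ j′ ⊖ j → j ≡ j′
⊖-transfer = from-yes (all? λ i → all? λ j → all? λ i′ → all? λ j′ →
  (i ≟ i′) →-dec (i′ ⊖ i ≟ j′ ⊖ j) →-dec (j ≟ j′))

⊖≡0⇒≡ : ∀ i j → i ⊖ j ≡ 0F → j ≡ i
⊖≡0⇒≡ = from-yes (all? λ i → all? λ j → (i ⊖ j ≟ 0F) →-dec (j ≟ i))

-- Nonzero opposite residues are 1 and 2 in some order, so testing for 1 separates them; this
-- produces the 2-colouring.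
signs-differ : ∀ i j → i ≢ 0F → i ≡ ⊝ j → does (i ≟ 1F) ≢ does (j ≟ 1F)
signs-differ 0F _  i≢0 _ _  = i≢0 refl
signs-differ 1F 2F _   _ ()
signs-differ 2F 1F _   _ ()
signs-differ 1F 0F _   () _
signs-differ 1F 1F _   () _
signs-differ 2F 0F _   () _
signs-differ 2F 2F _   () _

-- Edges and their ends

module _ {n : ℕ} {G : Graph (Fin n)} where

  open Graph G
  open Edge

  end₁≢end₂ : (e : Edge G) → end₁ e ≢ end₂ e
  end₁≢end₂ e p = Fin.<-irrefl p (ordered e)

  ends-adjacent : (e : Edge G) → end₁ e ~ end₂ e
  ends-adjacent (edge _ _ _ u~v) = recompute (_ ~? _) u~v

  ends-unique : ∀ (e f : Edge G) {u v : Fin n} → u ≢ v → u ∈ e → v ∈ e → u ∈ f → v ∈ f → e ≡ f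
  ends-unique e f u≢v u∈e v∈e u∈f v∈f = decidable-stable (e ≟ᵉ f) λ e≢f →
    u≢v (shareVertex-unique e f e≢f u∈e u∈f v∈e v∈f)

  third-end : ∀ (e : Edge G) {u v w : Fin n} → u ≢ v → u ∈ e → v ∈ e → w ∈ e → w ≡ u ⊎ w ≡ v
  third-end _ u≢v (inj₁ refl) (inj₁ refl) _           = contradiction refl u≢v
  third-end _ u≢v (inj₂ refl) (inj₂ refl) _           = contradiction refl u≢v
  third-end _ u≢v (inj₁ refl) (inj₂ refl) w∈e         = w∈e
  third-end _ u≢v (inj₂ refl) (inj₁ refl) (inj₁ refl) = inj₂ refl
  third-end _ u≢v (inj₂ refl) (inj₁ refl) (inj₂ refl) = inj₁ refl

  ends⇒~ : ∀ (e : Edge G) {u v : Fin n} → u ≢ v → u ∈ e → v ∈ e → u ~ v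
  ends⇒~ e u≢v (inj₁ refl) (inj₁ refl) = contradiction refl u≢v
  ends⇒~ e u≢v (inj₂ refl) (inj₂ refl) = contradiction refl u≢v
  ends⇒~ e u≢v (inj₁ refl) (inj₂ refl) = ends-adjacent e
  ends⇒~ e u≢v (inj₂ refl) (inj₁ refl) = ~-sym (ends-adjacent e)

  ~⇒≢ : ∀ {u v} → u ~ v → u ≢ v
  ~⇒≢ u~v u≡v = ~-irrefl u≡v u~v

  edge-joining : ∀ {u v} → u ~ v → ∃ λ (e : Edge G) → u ∈ e × v ∈ e
  edge-joining {u} {v} u~v with Fin.<-cmp u v
  ... | tri< u<v _ _ = edge u v u<v u~v , inj₁ refl , inj₂ refl
  ... | tri≈ _ u≡v _ = contradiction u~v (~-irrefl u≡v)
  ... | tri> _ _ v<u = edge v u v<u (~-sym u~v) , inj₂ refl , inj₁ refl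

  other : Edge G → Fin n → Fin n
  other e v with v ≟ end₁ e
  ... | yes _ = end₂ e
  ... | no _  = end₁ e

  other∈ : ∀ e v → other e v ∈ e
  other∈ e v with v ≟ end₁ e
  ... | yes _ = inj₂ refl
  ... | no _  = inj₁ refl

  other≢ : ∀ e v → other e v ≢ v
  other≢ e v with v ≟ end₁ e
  ... | yes refl = ≢-sym (end₁≢end₂ e)
  ... | no v≢    = ≢-sym v≢

  other-unique : ∀ (e : Edge G) {u v : Fin n} → u ≢ v → u ∈ e → v ∈ e → u ≡ other e v
  other-unique e {u} {v} u≢v u∈e v∈e
    with third-end e (other≢ e v) (other∈ e v) v∈e u∈e
  ... | inj₁ p = p
  ... | inj₂ p = contradiction p u≢v

  -- An edge amounts to a pair of vertices, its proofs being irrelevant and recoverable by decision.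
  -- The search therefore runs over all pairs of vertices.
  any-edge? : {P : Edge G → Set} → (∀ e → Dec (P e)) → Dec (∃ P)
  any-edge? {P} P? = map′
    (λ (u , v , u<v , u~v , p) → edge u v u<v u~v , p)
    (λ (e , p) → end₁ e , end₂ e , ordered e , ends-adjacent e , p)
    (any? λ u → any? λ v → joining? u v)
    where
    joining? : ∀ u v → Dec (Σ (u Fin.< v) λ u<v → Σ (u ~ v) λ u~v → P (edge u v u<v u~v))
    joining? u v with u Fin.<? v | u ~? v
    ... | no u≮v  | _       = no λ (u<v , _) → u≮v u<v
    ... | yes _   | no ¬u~v = no λ (_ , u~v , _) → ¬u~v u~v
    ... | yes u<v | yes u~v = map′ (λ p → u<v , u~v , p) (λ (_ , _ , p) → p)
                                   (P? (edge u v u<v u~v))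

  all-edges? : {P : Edge G → Set} → (∀ e → Dec (P e)) → Dec (∀ e → P e)
  all-edges? P? = map′
    (λ ¬∃ e → decidable-stable (P? e) λ ¬p → ¬∃ (e , ¬p))
    (λ ∀p (e , ¬p) → ¬p (∀p e))
    (¬? (any-edge? (λ e → ¬? (P? e))))

  propagate : Connected G → {P : Fin n → Set} → (∀ {u v} → P u → u ~ v → P v) →
              ∀ {u} → P u → ∀ v → P v
  propagate connected {P} step {u} p v = walk p (connected u v)
    where
    walk : ∀ {u v} → P u → Star _~_ u v → P v
    walk p ε       = p
    walk p (a ◅ s) = walk (step p a) s

-- Phases

Phases : ∀ {n} → Graph (Fin n) → Set
Phases {n} G = Edge G → Fin n → Fin 3

phaseOf : {A B : Set} → Dec A → Dec B → Fin 3
phaseOf (yes _) _       = 1F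
phaseOf (no _)  (yes _) = 2F
phaseOf (no _)  (no _)  = 0F

module _ {n : ℕ} {G : Graph (Fin n)} where

  open Graph G

  Alternating : Phases G → Set
  Alternating y = ∀ e {u v} → u ≢ v → u ∈ e → v ∈ e → y e u ≡ ⊝ y e v

  infix 4 _≈ₚ_

  -- Comparison is restricted to ends, because the value of `phase X e` at a vertex outside `e` says
  -- nothing about `e`.
  _≈ₚ_ : Phases G → Phases G → Set
  y ≈ₚ y′ = ∀ e {v} → v ∈ e → y e v ≡ y′ e v

  phase : Orientation G → Phases G
  phase X e v = phaseOf (Arc? (other e v) v) (Arc? v (other e v))
    where open Orientation X

  module _ (X : Orientation G) where

    open Orientation X

    phase-view : ∀ e v →
      (phase X e v ≡ 1F × Arc (other e v) v) ⊎
      (phase X e v ≡ 2F × Arc v (other e v)) ⊎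
      (phase X e v ≡ 0F × ¬ Arc (other e v) v × ¬ Arc v (other e v))
    phase-view e v with Arc? (other e v) v | Arc? v (other e v)
    ... | yes a | _     = inj₁ (refl , a)
    ... | no _  | yes b = inj₂ (inj₁ (refl , b))
    ... | no ¬a | no ¬b = inj₂ (inj₂ (refl , ¬a , ¬b))

    phase-1⇔ : ∀ e {u v} → u ≢ v → u ∈ e → v ∈ e → Arc u v ⇔ phase X e v ≡ 1F
    phase-1⇔ e {u} {v} u≢v u∈e v∈e
      with refl ← other-unique e u≢v u∈e v∈e | phase-view e v
    ... | inj₁ (p , a)              = mk⇔ (λ _ → p) (λ _ → a)
    ... | inj₂ (inj₁ (p , b))       = mk⇔ (λ a → contradiction b (Arc-asym a))
                                          (λ q → contradiction (trans (sym p) q) λ ())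
    ... | inj₂ (inj₂ (p , ¬a , _)) = mk⇔ (λ a → contradiction a ¬a)
                                          (λ q → contradiction (trans (sym p) q) λ ())

    phase-2⇔ : ∀ e {u v} → u ≢ v → u ∈ e → v ∈ e → Arc v u ⇔ phase X e v ≡ 2F
    phase-2⇔ e {u} {v} u≢v u∈e v∈e
      with refl ← other-unique e u≢v u∈e v∈e | phase-view e v
    ... | inj₁ (p , a)              = mk⇔ (λ b → contradiction b (Arc-asym a))
                                          (λ q → contradiction (trans (sym p) q) λ ())
    ... | inj₂ (inj₁ (p , b))       = mk⇔ (λ _ → p) (λ _ → b)
    ... | inj₂ (inj₂ (p , _ , ¬b)) = mk⇔ (λ b → contradiction b ¬b)
                                          (λ q → contradiction (trans (sym p) q) λ ())

    phase-0⇔ : ∀ e {u v} → u ≢ v → u ∈ e → v ∈ e →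
               (¬ Arc u v × ¬ Arc v u) ⇔ phase X e v ≡ 0F
    phase-0⇔ e {u} {v} u≢v u∈e v∈e
      with refl ← other-unique e u≢v u∈e v∈e | phase-view e v
    ... | inj₁ (p , a)              = mk⇔ (λ (¬a , _) → contradiction a ¬a)
                                          (λ q → contradiction (trans (sym p) q) λ ())
    ... | inj₂ (inj₁ (p , b))       = mk⇔ (λ (_ , ¬b) → contradiction b ¬b)
                                          (λ q → contradiction (trans (sym p) q) λ ())
    ... | inj₂ (inj₂ (p , ¬a , ¬b)) = mk⇔ (λ _ → p) (λ _ → ¬a , ¬b)

    phase-alternating : Alternating (phase X)
    phase-alternating e {u} {v} u≢v u∈e v∈e
      with refl ← other-unique e u≢v u∈e v∈e | phase-view e v
    ... | inj₁ (p , a) =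
      trans (to (phase-2⇔ e (≢-sym u≢v) v∈e u∈e) a) (cong ⊝_ (sym p))
    ... | inj₂ (inj₁ (p , b)) =
      trans (to (phase-1⇔ e (≢-sym u≢v) v∈e u∈e) b) (cong ⊝_ (sym p))
    ... | inj₂ (inj₂ (p , ¬a , ¬b)) =
      trans (to (phase-0⇔ e (≢-sym u≢v) v∈e u∈e) (¬b , ¬a)) (cong ⊝_ (sym p))

    private
      D : MixedGraph (Fin n)
      D = mixed X

    head⇔ : ∀ e {v} → v ∈ e → HasHead D e v ⇔ phase X e v ≡ 1F
    head⇔ e {v} v∈e = mk⇔
      (λ (u , u∈e , _ , a) → to (phase-1⇔ e (~⇒≢ {G = G} (Arc⇒~ a)) u∈e v∈e) a)
      (λ p → other e v , other∈ e v , v∈e ,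
             from (phase-1⇔ e (other≢ e v) (other∈ e v) v∈e) p)

    tail⇔ : ∀ e {v} → v ∈ e → HasTail D e v ⇔ phase X e v ≡ 2F
    tail⇔ e {v} v∈e = mk⇔
      (λ (u , u∈e , _ , a) → to (phase-2⇔ e (≢-sym (~⇒≢ {G = G} (Arc⇒~ a))) u∈e v∈e) a)
      (λ p → other e v , other∈ e v , v∈e ,
             from (phase-2⇔ e (other≢ e v) (other∈ e v) v∈e) p)

    digon⇔ : ∀ e {v} → v ∈ e → IsDigon D e ⇔ phase X e v ≡ 0F
    digon⇔ e {v} (inj₁ refl) = mk⇔ (to eq ∘ swap) (swap ∘ from eq)
      where eq = phase-0⇔ e (≢-sym (end₁≢end₂ e)) (inj₂ refl) (inj₁ refl)
    digon⇔ e {v} (inj₂ refl) = phase-0⇔ e (end₁≢end₂ e) (inj₁ refl) (inj₂ refl)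

    -- Distinct edges share at most one vertex, so the arc is witnessed at `v` itself. There the
    -- three constructors of `LArcAt` are the three solutions of `j ≡ 1F ⊕ i`: from 1 to 2, from 0
    -- to 1 and from 2 to 0.
    LArc⇔ : ∀ {e f v} → e ≢ f → v ∈ e → v ∈ f →
            LArc D e f ⇔ phase X f v ≡ 1F ⊕ phase X e v
    LArc⇔ {e} {f} {v} e≢f v∈e v∈f = mk⇔ forth (λ p → e≢f , v , v∈e , v∈f , back p)
      where
      forth : LArc D e f → phase X f v ≡ 1F ⊕ phase X e v
      forth (_ , w , w∈e , w∈f , a) with refl ← shareVertex-unique e f e≢f v∈e v∈f w∈e w∈f | a
      ... | head-tail h t  = trans (to (tail⇔ f v∈f) t) (cong (1F ⊕_) (sym (to (head⇔ e v∈e) h)))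
      ... | digon-head d h = trans (to (head⇔ f v∈f) h) (cong (1F ⊕_) (sym (to (digon⇔ e v∈e) d)))
      ... | tail-digon t d = trans (to (digon⇔ f v∈f) d) (cong (1F ⊕_) (sym (to (tail⇔ e v∈e) t)))
      back : phase X f v ≡ 1F ⊕ phase X e v → LArcAt D v e f
      back p with phase X e v in q
      ... | 0F = digon-head (from (digon⇔ e v∈e) q) (from (head⇔ f v∈f) p)
      ... | 1F = head-tail (from (head⇔ e v∈e) q) (from (tail⇔ f v∈f) p)
      ... | 2F = tail-digon (from (tail⇔ e v∈e) q) (from (digon⇔ f v∈f) p)

  -- Passing between orientations and phases

  ≋⇒≈ₚ : (X X′ : Orientation G) → X ≋ X′ → phase X ≈ₚ phase X′
  ≋⇒≈ₚ X X′ X≋X′ e {v} v∈e with phase-view X e v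
  ... | inj₁ (p , a) =
    trans p (sym (to (phase-1⇔ X′ e (other≢ e v) (other∈ e v) v∈e) (to (X≋X′ _ _) a)))
  ... | inj₂ (inj₁ (p , b)) =
    trans p (sym (to (phase-2⇔ X′ e (other≢ e v) (other∈ e v) v∈e) (to (X≋X′ _ _) b)))
  ... | inj₂ (inj₂ (p , ¬a , ¬b)) =
    trans p (sym (to (phase-0⇔ X′ e (other≢ e v) (other∈ e v) v∈e)
                     (¬a ∘ from (X≋X′ _ _) , ¬b ∘ from (X≋X′ _ _))))

  ≈ₚ⇒≋ : (X X′ : Orientation G) → phase X ≈ₚ phase X′ → X ≋ X′
  ≈ₚ⇒≋ X X′ y≈y′ u v = mk⇔ (transfer X X′ y≈y′) (transfer X′ X λ e v∈e → sym (y≈y′ e v∈e))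
    where
    transfer : (X X′ : Orientation G) → phase X ≈ₚ phase X′ →
               Orientation.Arc X u v → Orientation.Arc X′ u v
    transfer X X′ y≈y′ a with e , u∈e , v∈e ← edge-joining {G = G} (Orientation.Arc⇒~ X a) =
      from (phase-1⇔ X′ e u≢v u∈e v∈e)
           (trans (sym (y≈y′ e v∈e)) (to (phase-1⇔ X e u≢v u∈e v∈e) a))
      where u≢v = ~⇒≢ {G = G} (Orientation.Arc⇒~ X a)

  -- An arc points to the end of phase 1. Phase 2 at an end gives the reverse arc, since alternation
  -- puts phase 1 at the opposite end. The condition `u ≢ v` excludes taking one end twice.
  orientationOf : (y : Phases G) → Alternating y → Orientation G
  orientationOf y alternating = record
    { Arc      = λ u v → ∃ λ (e : Edge G) → u ≢ v × u ∈ e × v ∈ e × y e v ≡ 1F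
    ; Arc⇒~    = λ (e , u≢v , u∈e , v∈e , _) → ends⇒~ e u≢v u∈e v∈e
    ; Arc-asym = asym
    ; Arc?     = λ u v → any-edge? λ e →
        ¬? (u ≟ v) ×-dec (u ∈? e) ×-dec (v ∈? e) ×-dec (y e v ≟ 1F)
    }
    where
    asym : ∀ {u v} → (∃ λ (e : Edge G) → u ≢ v × u ∈ e × v ∈ e × y e v ≡ 1F) →
           ¬ (∃ λ (e : Edge G) → v ≢ u × v ∈ e × u ∈ e × y e u ≡ 1F)
    asym (e , u≢v , u∈e , v∈e , p) (f , _ , v∈f , u∈f , q)
      with refl ← ends-unique e f u≢v u∈e v∈e u∈f v∈f =
      contradiction (trans (sym q) (trans (alternating e u≢v u∈e v∈e) (cong ⊝_ p))) λ ()

  phase-orientationOf : ∀ y (alternating : Alternating y) →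
                        phase (orientationOf y alternating) ≈ₚ y
  phase-orientationOf y alternating e {v} v∈e
    with phase-view (orientationOf y alternating) e v
  ... | inj₁ (p , f , u≢v , u∈f , v∈f , q)
      with refl ← ends-unique e f u≢v (other∈ e v) v∈e u∈f v∈f = trans p (sym q)
  ... | inj₂ (inj₁ (p , f , v≢u , v∈f , u∈f , q))
      with refl ← ends-unique e f v≢u v∈e (other∈ e v) v∈f u∈f =
      trans p (sym (trans (alternating e v≢u v∈e (other∈ e v)) (cong ⊝_ q)))
  ... | inj₂ (inj₂ (p , ¬a , ¬b)) with y e v in q
  ... | 0F = p
  ... | 1F = contradiction (e , other≢ e v , other∈ e v , v∈e , q) ¬a
  ... | 2F = contradiction
    (e , ≢-sym (other≢ e v) , v∈e , other∈ e v ,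
     trans (alternating e (other≢ e v) (other∈ e v) v∈e) (cong ⊝_ q)) ¬b

-- Root orientations as phases

module _ {n : ℕ} {W : Set} {G : Graph (Fin n)} (Y : MixedGraph W) (φ : Root G (Γ Y)) where

  open Graph G
  open Edge
  private
    module Y = MixedGraph Y
    module φ = _≅_ φ

  Realises : Phases G → Set
  Realises y = ∀ {e f : Edge G} {v} → e ≢ f → v ∈ e → v ∈ f →
               Y.Arc (φ.to e) (φ.to f) ⇔ y f v ≡ 1F ⊕ y e v

  phase-realises : ((X , _) : RootOrientation Y φ) → Realises (phase X)
  phase-realises (X , p) {e} {f} e≢f v∈e v∈f =
    ⇔.trans (⇔.sym (p e f)) (LArc⇔ X e≢f v∈e v∈f)

  realisation : (y : Phases G) → Alternating y → Realises y → RootOrientation Y φ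
  realisation y alternating realises = X , λ e f → mk⇔
    (λ a@(e≢f , v , v∈e , v∈f , _) → from (arc⇔ e≢f v∈e v∈f) a)
    (λ a → let e≢f , v , v∈e , v∈f = from (φ.preserves e f) (Y.Arc⇒~ a) in
           to (arc⇔ e≢f v∈e v∈f) a)
    where
    X = orientationOf y alternating
    arc⇔ : ∀ {e f v} → e ≢ f → v ∈ e → v ∈ f →
           Y.Arc (φ.to e) (φ.to f) ⇔ LArc (mixed X) e f
    arc⇔ {e} {f} {v} e≢f v∈e v∈f =
      ⇔.trans (realises e≢f v∈e v∈f) (⇔.sym
        (subst (λ i → LArc (mixed X) e f ⇔ i ≡ 1F ⊕ y e v) (≈y f v∈f)
          (subst (λ i → LArc (mixed X) e f ⇔ phase X f v ≡ 1F ⊕ i) (≈y e v∈e)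
            (LArc⇔ X e≢f v∈e v∈f))))
      where ≈y = phase-orientationOf y alternating

  -- The arcs of `Y` between `e` and `f`, in either direction or absent, fix the difference modulo 3
  -- of their phases at `v`. Both `y` and `y′` have this difference, so `y′` minus `y` depends on
  -- the vertex alone.
  difference-constant : ∀ {y y′} → Realises y → Realises y′ → ∀ {e f : Edge G} {v} →
                        v ∈ e → v ∈ f → y′ e v ⊖ y e v ≡ y′ f v ⊖ y f v
  difference-constant r r′ {e} {f} v∈e v∈f with e ≟ᵉ f
  ... | yes refl = refl
  ... | no e≢f   = ⊖-determined
    (⇔.trans (⇔.sym (r e≢f v∈e v∈f)) (r′ e≢f v∈e v∈f))
    (⇔.trans (⇔.sym (r (≢-sym e≢f) v∈f v∈e)) (r′ (≢-sym e≢f) v∈f v∈e))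

  -- Agreement on one edge at a vertex spreads to all edges there by `difference-constant`, and from
  -- one end of an edge to the other by alternation.
  agreement-propagates : Connected G → ∀ {y y′} →
    Alternating y → Realises y → Alternating y′ → Realises y′ →
    ∀ {e v} → v ∈ e → y e v ≡ y′ e v → y ≈ₚ y′
  agreement-propagates connected {y} {y′} alt r alt′ r′ {e} {v} v∈e p f {w} w∈f =
    propagate {G = G} connected {Agree} step (spread v∈e p) w f w∈f
    where
    Agree : Fin n → Set
    Agree v = ∀ e → v ∈ e → y e v ≡ y′ e v
    spread : ∀ {e v} → v ∈ e → y e v ≡ y′ e v → Agree v
    spread v∈e p f v∈f = ⊖-transfer _ _ _ _ p (difference-constant r r′ v∈e v∈f)
    step : ∀ {u v} → Agree u → u ~ v → Agree v
    step agree u~v with f , u∈f , v∈f ← edge-joining {G = G} u~v =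
      spread v∈f (trans (alt f v≢u v∈f u∈f)
                 (trans (cong ⊝_ (agree f u∈f)) (sym (alt′ f v≢u v∈f u∈f))))
      where v≢u = ≢-sym (~⇒≢ {G = G} u~v)

  -- Counting from one given root orientation

  private
    module _ (connected : Connected G) (e₀ : Edge G) (R₀ : RootOrientation Y φ) where

      v₀ : Fin n
      v₀ = end₁ e₀

      v₀∈e₀ : v₀ ∈ e₀
      v₀∈e₀ = inj₁ refl

      y₀ : Phases G
      y₀ = phase (proj₁ R₀)

      y₀-alternating : Alternating y₀
      y₀-alternating = phase-alternating (proj₁ R₀)

      signed : Bool → Fin 3 → Fin 3
      signed true  t = t
      signed false t = ⊝ t

      signed-involutive : ∀ b t → signed b (signed b t) ≡ t
      signed-involutive true  = λ _ → refl
      signed-involutive false = ⊝-involutive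

      signed-≢ : ∀ {b b′} t → b ≢ b′ → signed b t ≡ ⊝ signed b′ t
      signed-≢ {true}  {true}  t b≢b′ = contradiction refl b≢b′
      signed-≢ {true}  {false} t b≢b′ = sym (⊝-involutive t)
      signed-≢ {false} {true}  t b≢b′ = refl
      signed-≢ {false} {false} t b≢b′ = contradiction refl b≢b′

      -- The phase of `e₀` at `v₀` is thus a complete coordinate on root orientations, with at most
      -- three values.
      agree⇒≋ : (R R′ : RootOrientation Y φ) →
                phase (proj₁ R) e₀ v₀ ≡ phase (proj₁ R′) e₀ v₀ → proj₁ R ≋ proj₁ R′
      agree⇒≋ R@(X , _) R′@(X′ , _) p = ≈ₚ⇒≋ X X′
        (agreement-propagates connected
          (phase-alternating X) (phase-realises R) (phase-alternating X′) (phase-realises R′)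
          v₀∈e₀ p)

      bipartite⇒three : Bipartite G → HasExactly 3 (RootOrientations Y φ)
      bipartite⇒three (c , proper) = record
        { to        = shifted
        ; from      = shiftAmount
        ; to-cong   = λ { {t} refl → IsEquivalence.refl ≋-isEquivalence {proj₁ (shifted t)} }
        ; from-cong = λ {R} {R′} → shiftAmount-cong {R} {R′}
        ; inverse   =
            (λ { {R} refl → agree⇒≋ (shifted (shiftAmount R)) R
                   (trans (phase-shifted (shiftAmount R))
                   (trans (cong (y₀ e₀ v₀ ⊕_) (signed-involutive (c v₀) _))
                          (i⊕[j⊖i]≡j (y₀ e₀ v₀) _))) })
          , (λ {t} {R} R≋ → trans (shiftAmount-cong {R} {shifted t} R≋)
                   (trans (cong (λ i → signed (c v₀) (i ⊖ y₀ e₀ v₀)) (phase-shifted t))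
                   (trans (cong (signed (c v₀)) ([i⊕j]⊖i≡j (y₀ e₀ v₀) _))
                          (signed-involutive (c v₀) t))))
        }
        where
        -- The shift is `t` on one colour class and `⊝ t` on the other: opposite at adjacent
        -- vertices, which keeps alternation, and constant at each vertex, which keeps the arcs.
        y : Fin 3 → Phases G
        y t e v = y₀ e v ⊕ signed (c v) t

        y-alternating : ∀ t → Alternating (y t)
        y-alternating t e {u} {v} u≢v u∈e v∈e = trans
          (cong₂ _⊕_ (y₀-alternating e u≢v u∈e v∈e)
                     (signed-≢ t (proper u v (ends⇒~ e u≢v u∈e v∈e))))
          (⊝-distrib-⊕ (y₀ e v) _)

        shifted : Fin 3 → RootOrientation Y φ
        shifted t = realisation (y t) (y-alternating t) λ {e} {f} {v} e≢f v∈e v∈f →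
          ⇔.trans (phase-realises R₀ e≢f v∈e v∈f) (suc-shift (y₀ f v) (y₀ e v) _)

        phase-shifted : ∀ t → phase (proj₁ (shifted t)) e₀ v₀ ≡ y t e₀ v₀
        phase-shifted t = phase-orientationOf (y t) (y-alternating t) e₀ v₀∈e₀

        -- The outer `signed` undoes the sign that the colour of `v₀` puts on the shift there.
        shiftAmount : RootOrientation Y φ → Fin 3
        shiftAmount (X , _) = signed (c v₀) (phase X e₀ v₀ ⊖ y₀ e₀ v₀)

        shiftAmount-cong : ∀ {R R′} → proj₁ R ≋ proj₁ R′ → shiftAmount R ≡ shiftAmount R′
        shiftAmount-cong {X , _} {X′ , _} X≋X′ =
          cong (λ i → signed (c v₀) (i ⊖ y₀ e₀ v₀)) (≋⇒≈ₚ X X′ X≋X′ e₀ v₀∈e₀)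

      -- The difference `δ` alternates, and it vanishes nowhere since a single zero would spread to
      -- `e₀` at `v₀`. Its sign is therefore a proper colouring.
      differ⇒bipartite : (R : RootOrientation Y φ) →
                         phase (proj₁ R) e₀ v₀ ≢ y₀ e₀ v₀ → Bipartite G
      differ⇒bipartite R@(X , _) p = colour , λ u v u~v →
        let f , u∈f , v∈f = edge-joining {G = G} u~v
            u≢v = ~⇒≢ {G = G} u~v
        in colours-differ f u∈f v∈f (δ-nonzero f u∈f) (δ-alternating f u≢v u∈f v∈f)
        where
        δ : Phases G
        δ e v = phase X e v ⊖ y₀ e v

        δ-alternating : Alternating δ
        δ-alternating e {u} {v} u≢v u∈e v∈e = trans
          (cong₂ _⊖_ (phase-alternating X e u≢v u∈e v∈e) (y₀-alternating e u≢v u∈e v∈e))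
          (⊝-distrib-⊕ (phase X e v) _)

        δ-nonzero : ∀ e {v} → v ∈ e → δ e v ≢ 0F
        δ-nonzero e {v} v∈e δ≡0 = p (sym (agreement-propagates connected
          y₀-alternating (phase-realises R₀) (phase-alternating X) (phase-realises R)
          v∈e (⊖≡0⇒≡ _ _ δ≡0) e₀ v₀∈e₀))

        positive? : ∀ v → Dec (∃ λ e → v ∈ e × δ e v ≡ 1F)
        positive? v = any-edge? λ e → (v ∈? e) ×-dec (δ e v ≟ 1F)

        -- All edges at `v` give the same answer by `difference-constant`; a vertex on no edge gets
        -- `false`.
        colour : Fin n → Bool
        colour v = does (positive? v)

        colour-≡ : ∀ e {v} → v ∈ e → colour v ≡ does (δ e v ≟ 1F)
        colour-≡ e {v} v∈e = does-⇔ (mk⇔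
          (λ (f , v∈f , q) →
             trans (difference-constant (phase-realises R₀) (phase-realises R) v∈e v∈f) q)
          (λ q → e , v∈e , q)) (positive? v) (δ e v ≟ 1F)

        colours-differ : ∀ e {u v} → u ∈ e → v ∈ e → δ e u ≢ 0F → δ e u ≡ ⊝ δ e v →
                         colour u ≢ colour v
        colours-differ e {u} {v} u∈e v∈e nonzero alt same =
          signs-differ _ _ nonzero alt
            (trans (sym (colour-≡ e u∈e)) (trans same (colour-≡ e v∈e)))

      ¬bipartite⇒one : ¬ Bipartite G → HasExactly 1 (RootOrientations Y φ)
      ¬bipartite⇒one ¬bipartite = record
        { to        = λ _ → R₀
        ; from      = λ _ → 0F
        ; to-cong   = λ _ → IsEquivalence.refl ≋-isEquivalence {proj₁ R₀}
        ; from-cong = λ _ → refl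
        ; inverse   =
            -- Equality of phases is decidable, so it is enough to refute their being different.
            (λ {R} _ → agree⇒≋ R₀ R (decidable-stable (_ ≟ _) λ p →
              ¬bipartite (differ⇒bipartite R (≢-sym p))))
          , λ { {0F} _ → refl }
        }

  count : Connected G → Edge G → RootOrientation Y φ →
          (Bipartite G → HasExactly 3 (RootOrientations Y φ)) ×
          (¬ Bipartite G → HasExactly 1 (RootOrientations Y φ))
  count connected e₀ R₀ =
    bipartite⇒three connected e₀ R₀ , ¬bipartite⇒one connected e₀ R₀

-- Line graph embeddings

module LineGraphEmbedding
  {n m : ℕ} {G : Graph (Fin n)} {H : Graph (Fin m)} (connected : Connected G)
  (θ : Edge G → Edge H) (θ-injective : ∀ {e f} → θ e ≡ θ f → e ≡ f)
  (θ-preserves : ∀ e f → Graph._~_ (L G) e f ⇔ Graph._~_ (L H) (θ e) (θ f))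
  where

  open Graph G
  open Edge

  θ-≢ : ∀ {e f} → e ≢ f → θ e ≢ θ f
  θ-≢ e≢f = e≢f ∘ θ-injective

  image-meet : ∀ {e f v} → e ≢ f → v ∈ e → v ∈ f → ∃ λ q → q ∈ θ e × q ∈ θ f
  image-meet {e} {f} {v} e≢f v∈e v∈f = proj₂ (to (θ-preserves e f) (e≢f , v , v∈e , v∈f))

  preimage-meet : ∀ {e f q} → e ≢ f → q ∈ θ e → q ∈ θ f → ∃ λ v → v ∈ e × v ∈ f
  preimage-meet {e} {f} {q} e≢f q∈e q∈f =
    proj₂ (from (θ-preserves e f) (θ-≢ e≢f , q , q∈e , q∈f))

  image-ends-unique : ∀ {e f q r} → q ≢ r → q ∈ θ e → r ∈ θ e → q ∈ θ f → r ∈ θ f → e ≡ f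
  image-ends-unique {e} {f} q≢r q∈e r∈e q∈f r∈f =
    θ-injective (ends-unique (θ e) (θ f) q≢r q∈e r∈e q∈f r∈f)

  -- At a vertex on a single edge `e`, either end of `θ e` can serve as its image; only a vertex on
  -- two edges imposes a condition.
  Branching : Fin n → Set
  Branching v = ∃ λ (e : Edge G) → ∃ λ (f : Edge G) → e ≢ f × v ∈ e × v ∈ f

  branching? : ∀ v → Dec (Branching v)
  branching? v = any-edge? λ e → any-edge? λ f → ¬? (e ≟ᵉ f) ×-dec (v ∈? e) ×-dec (v ∈? f)

  StarImage : Fin n → Fin m → Set
  StarImage v q = ∀ e → v ∈ e → q ∈ θ e

  starImage? : ∀ v q → Dec (StarImage v q)
  starImage? v q = all-edges? λ e → (v ∈? e) →-dec (q ∈? θ e)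

  -- The vertex `z` cannot be `x`: then `e` and `k` would share it, so it would be `v`, which is not
  -- on `h`. Hence `h` joins `x` on `e` to `z` on `k`, and `y` is one of these.
  meets-second-edge : ∀ {e k} (h : Edge G) {v x y} → v ∈ e → v ∈ k → k ≢ e → ¬ v ∈ h →
    x ∈ e → x ∈ h → y ∈ h → ShareVertex h k → y ∈ e ⊎ y ∈ k
  meets-second-edge {e} {k} h {v} {x} {y} v∈e v∈k k≢e v∉h x∈e x∈h y∈h (z , z∈h , z∈k)
    with y ≟ z
  ... | yes refl = inj₂ z∈k
  ... | no y≢z with third-end h y≢z y∈h z∈h x∈h
  ...   | inj₁ refl = inj₁ x∈e
  ...   | inj₂ refl = contradiction
    (subst (_∈ h) (shareVertex-unique k e k≢e z∈k x∈e v∈k v∈e) x∈h) v∉h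

  -- Claws sent onto triangles

  record ClawOntoTriangle (v : Fin n) (e f g : Edge G) (q r s : Fin m) : Set where
    field
      v∈e  : v ∈ e
      v∈f  : v ∈ f
      v∈g  : v ∈ g
      e≢f  : e ≢ f
      f≢g  : f ≢ g
      g≢e  : g ≢ e
      -- The images are the sides qr, qs and rs of a triangle, which has the same line graph as the
      -- claw.
      q∈θe : q ∈ θ e
      q∈θf : q ∈ θ f
      r∈θe : r ∈ θ e
      r∈θg : r ∈ θ g
      s∈θf : s ∈ θ f
      s∈θg : s ∈ θ g
      q≢r  : q ≢ r
      q≢s  : q ≢ s
      r≢s  : r ≢ s

  -- By this cyclic symmetry, what is proved for `e` also holds for `f` and `g`.
  rotate : ∀ {v e f g q r s} → ClawOntoTriangle v e f g q r s → ClawOntoTriangle v f g e s q r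
  rotate c = record
    { v∈e = v∈f ; v∈f = v∈g ; v∈g = v∈e
    ; e≢f = f≢g ; f≢g = g≢e ; g≢e = e≢f
    ; q∈θe = s∈θf ; q∈θf = s∈θg
    ; r∈θe = q∈θf ; r∈θg = q∈θe
    ; s∈θf = r∈θg ; s∈θg = r∈θe
    ; q≢r = ≢-sym q≢s ; q≢s = ≢-sym r≢s ; r≢s = q≢r
    }
    where open ClawOntoTriangle c

  module _ {v e f g q r s} (c : ClawOntoTriangle v e f g q r s) where

    open ClawOntoTriangle c

    -- The image of a fourth edge would meet all three sides. No corner lies on all of them, so the
    -- image would contain two corners and be a side, against injectivity.
    no-fourth-edge : ∀ {h} → v ∈ h → ¬ (h ≢ e × h ≢ f × h ≢ g)
    no-fourth-edge {h} v∈h (h≢e , h≢f , h≢g)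
      with image-meet h≢e v∈h v∈e | image-meet h≢f v∈h v∈f | image-meet h≢g v∈h v∈g
    ... | x , x∈h , x∈e | y , y∈h , y∈f | z , z∈h , z∈g
      with third-end (θ e) q≢r q∈θe r∈θe x∈e | third-end (θ f) q≢s q∈θf s∈θf y∈f
         | third-end (θ g) r≢s r∈θg s∈θg z∈g
    ... | inj₁ refl | _         | inj₁ refl = h≢e (image-ends-unique q≢r x∈h z∈h q∈θe r∈θe)
    ... | inj₁ refl | _         | inj₂ refl = h≢f (image-ends-unique q≢s x∈h z∈h q∈θf s∈θf)
    ... | inj₂ refl | inj₁ refl | _         = h≢e (image-ends-unique q≢r y∈h x∈h q∈θe r∈θe)
    ... | inj₂ refl | inj₂ refl | _         = h≢g (image-ends-unique r≢s x∈h y∈h r∈θg s∈θg)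

    -- Every other edge of H at an end of a triangle edge is adjacent to exactly two
    -- edges of the triangle.
    claw-closed-at-e : ∀ h {x y} → x ∈ e → x ∈ h → y ∈ h → y ∈ e ⊎ y ∈ f ⊎ y ∈ g
    claw-closed-at-e h {x} {y} x∈e x∈h y∈h with h ≟ᵉ e | h ≟ᵉ f | h ≟ᵉ g
    ... | yes refl | _        | _        = inj₁ y∈h
    ... | no _     | yes refl | _        = inj₂ (inj₁ y∈h)
    ... | no _     | no _     | yes refl = inj₂ (inj₂ y∈h)
    ... | no h≢e   | no h≢f   | no h≢g
      with v ∈? h | image-meet h≢e x∈h x∈e
    ... | yes v∈h | _ = contradiction (h≢e , h≢f , h≢g) (no-fourth-edge v∈h)
    ... | no v∉h  | p , p∈h , p∈e with third-end (θ e) q≢r q∈θe r∈θe p∈e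
    ...   | inj₁ refl with meets-second-edge h v∈e v∈f (≢-sym e≢f) v∉h x∈e x∈h y∈h
                             (preimage-meet h≢f p∈h q∈θf)
    ...     | inj₁ y∈e = inj₁ y∈e
    ...     | inj₂ y∈f = inj₂ (inj₁ y∈f)
    claw-closed-at-e h {x} {y} x∈e x∈h y∈h | no h≢e | no h≢f | no h≢g
        | no v∉h  | p , p∈h , p∈e
          | inj₂ refl with meets-second-edge h v∈e v∈g g≢e v∉h x∈e x∈h y∈h
                             (preimage-meet h≢g p∈h r∈θg)
    ...     | inj₁ y∈e = inj₁ y∈e
    ...     | inj₂ y∈g = inj₂ (inj₂ y∈g)

  -- The ends of the claw are closed under adjacency, so by connectedness they are all the vertices.
  -- The centre and its three distinct leaves then give injections between `Fin n` and `Fin 4` both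
  -- ways.
  claw⇒exception : ∀ {v e f g q r s} → ClawOntoTriangle v e f g q r s → WhitneyException G
  claw⇒exception {v} {e} {f} {g} c =
    Fin.cantor-schröder-bernstein index-injective (λ {i} {j} → lookup-injective unique i j) ,
    v , adjacent-to-v
    where
    open ClawOntoTriangle c

    covered : ∀ y → y ∈ e ⊎ y ∈ f ⊎ y ∈ g
    covered = propagate {G = G} connected {λ y → y ∈ e ⊎ y ∈ f ⊎ y ∈ g} step (inj₁ v∈e)
      where
      step : ∀ {x y} → x ∈ e ⊎ x ∈ f ⊎ x ∈ g → x ~ y → y ∈ e ⊎ y ∈ f ⊎ y ∈ g
      step x∈ x~y with edge-joining {G = G} x~y
      step (inj₁ x∈e) x~y | h , x∈h , y∈h = claw-closed-at-e c h x∈e x∈h y∈h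
      step (inj₂ (inj₁ x∈f)) x~y | h , x∈h , y∈h
        with claw-closed-at-e (rotate c) h x∈f x∈h y∈h
      ... | inj₁ y∈f        = inj₂ (inj₁ y∈f)
      ... | inj₂ (inj₁ y∈g) = inj₂ (inj₂ y∈g)
      ... | inj₂ (inj₂ y∈e) = inj₁ y∈e
      step (inj₂ (inj₂ x∈g)) x~y | h , x∈h , y∈h
        with claw-closed-at-e (rotate (rotate c)) h x∈g x∈h y∈h
      ... | inj₁ y∈g        = inj₂ (inj₂ y∈g)
      ... | inj₂ (inj₁ y∈e) = inj₁ y∈e
      ... | inj₂ (inj₂ y∈f) = inj₂ (inj₁ y∈f)

    adjacent-to-v : ∀ w → w ≢ v → v ~ w
    adjacent-to-v w w≢v with covered w
    ... | inj₁ w∈e        = ends⇒~ e (≢-sym w≢v) v∈e w∈e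
    ... | inj₂ (inj₁ w∈f) = ends⇒~ f (≢-sym w≢v) v∈f w∈f
    ... | inj₂ (inj₂ w∈g) = ends⇒~ g (≢-sym w≢v) v∈g w∈g

    other-≢ : ∀ {e f : Edge G} → e ≢ f → v ∈ e → v ∈ f → other e v ≢ other f v
    other-≢ {e} {f} e≢f v∈e v∈f p = e≢f (ends-unique e f (other≢ e v)
      (other∈ e v) v∈e (subst (_∈ f) (sym p) (other∈ f v)) v∈f)

    vertices : Vec (Fin n) 4
    vertices = v ∷ other e v ∷ other f v ∷ other g v ∷ []

    unique : Unique vertices
    unique = (≢-sym (other≢ e v) ∷ ≢-sym (other≢ f v) ∷ ≢-sym (other≢ g v) ∷ [])
           ∷ (other-≢ e≢f v∈e v∈f ∷ other-≢ (≢-sym g≢e) v∈e v∈g ∷ [])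
           ∷ (other-≢ f≢g v∈f v∈g ∷ []) ∷ [] ∷ []

    index : ∀ y → ∃ λ i → lookup vertices i ≡ y
    index y with y ≟ v | covered y
    ... | yes p  | _               = 0F , sym p
    ... | no y≢v | inj₁ y∈e        = 1F , sym (other-unique e y≢v y∈e v∈e)
    ... | no y≢v | inj₂ (inj₁ y∈f) = 2F , sym (other-unique f y≢v y∈f v∈f)
    ... | no y≢v | inj₂ (inj₂ y∈g) = 3F , sym (other-unique g y≢v y∈g v∈g)

    index-injective : ∀ {x y} → proj₁ (index x) ≡ proj₁ (index y) → x ≡ y
    index-injective {x} {y} p =
      trans (sym (proj₂ (index x))) (trans (cong (lookup vertices) p) (proj₂ (index y)))

  -- If the image of some `g` at `v` misses the common end `q` of `θ e` and `θ f`, it meets each of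
  -- these at its other end. The two ends are distinct because `θ e` and `θ f` are, and a triangle
  -- results.
  starImage-or-exception : ∀ v → Branching v → ∃ (StarImage v) ⊎ WhitneyException G
  starImage-or-exception v (e , f , e≢f , v∈e , v∈f) with image-meet e≢f v∈e v∈f
  ... | q , q∈θe , q∈θf with any-edge? (λ g → (v ∈? g) ×-dec ¬? (q ∈? θ g))
  ... | no ¬g = inj₁ (q , λ g v∈g → decidable-stable (q ∈? θ g) λ q∉θg → ¬g (g , v∈g , q∉θg))
  ... | yes (g , v∈g , q∉θg) with image-meet g≢e v∈g v∈e | image-meet g≢f v∈g v∈f
    where
    g≢e : g ≢ e
    g≢e refl = q∉θg q∈θe
    g≢f : g ≢ f
    g≢f refl = q∉θg q∈θf
  ... | r , r∈θg , r∈θe | s , s∈θg , s∈θf = inj₂ (claw⇒exception record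
    { v∈e = v∈e ; v∈f = v∈f ; v∈g = v∈g
    ; e≢f = e≢f ; f≢g = λ { refl → q∉θg q∈θf } ; g≢e = λ { refl → q∉θg q∈θe }
    ; q∈θe = q∈θe ; q∈θf = q∈θf
    ; r∈θe = r∈θe ; r∈θg = r∈θg
    ; s∈θf = s∈θf ; s∈θg = s∈θg
    ; q≢r = q≢r ; q≢s = λ { refl → q∉θg s∈θg }
    ; r≢s = λ { refl → e≢f (image-ends-unique q≢r q∈θe r∈θe q∈θf s∈θf) }
    })
    where
    q≢r : q ≢ r
    q≢r refl = q∉θg r∈θg

  -- Maps of ends, and triangles sent onto stars

  record TriangleOntoStar : Set where
    field
      {u v w} : Fin n
      {e f g} : Edge G
      {q}     : Fin m
      u≢v : u ≢ v
      u≢w : u ≢ w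
      v≢w : v ≢ w
      u∈e : u ∈ e
      v∈e : v ∈ e
      u∈f : u ∈ f
      w∈f : w ∈ f
      v∈g : v ∈ g
      w∈g : w ∈ g
      -- No `EndMap` exists here: distinct images share only `q`, so both ends of each edge would
      -- have to go to `q`.
      q∈θ : ∀ h → q ∈ θ h
      all : ∀ h → h ≡ e ⊎ h ≡ f ⊎ h ≡ g

  -- ι e v is the end of θ e that corresponds to the end v of e.
  record EndMap : Set where
    field
      ι          : Edge G → Fin n → Fin m
      ι∈         : ∀ e {v} → v ∈ e → ι e v ∈ θ e
      ι-injective : ∀ e {u v} → u ≢ v → u ∈ e → v ∈ e → ι e u ≢ ι e v
      ι-agrees   : ∀ {e f v} → e ≢ f → v ∈ e → v ∈ f → ι e v ≡ ι f v

  record OrderedEnds (e : Edge G) : Set where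
    field
      {image₁ image₂} : Fin m
      image₁≢image₂ : image₁ ≢ image₂
      image₁∈ : image₁ ∈ θ e
      image₂∈ : image₂ ∈ θ e
      star₁ : Branching (end₁ e) → StarImage (end₁ e) image₁
      star₂ : Branching (end₂ e) → StarImage (end₂ e) image₂

  module _ (star : ∀ v → Branching v → ∃ (StarImage v)) where

    private
      -- The image of an edge `h` at `u` contains `q`, as does `θ g`. So `h` meets `g` in `v` or
      -- `w`, which makes it the side from `u` to that vertex.
      edges-at-corner : ∀ e f g {u v w q} → u ≢ v → u ≢ w → v ≢ w →
        u ∈ e → v ∈ e → u ∈ f → w ∈ f → v ∈ g → w ∈ g →
        StarImage u q → q ∈ θ g → ∀ h → u ∈ h → h ≡ e ⊎ h ≡ f
      edges-at-corner e f g u≢v u≢w v≢w u∈e v∈e u∈f w∈f v∈g w∈g q∈ q∈θg h u∈h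
        with h ≟ᵉ g
      ... | yes refl with third-end g v≢w v∈g w∈g u∈h
      ...   | inj₁ u≡v = contradiction u≡v u≢v
      ...   | inj₂ u≡w = contradiction u≡w u≢w
      edges-at-corner e f g u≢v u≢w v≢w u∈e v∈e u∈f w∈f v∈g w∈g q∈ q∈θg h u∈h
          | no h≢g with preimage-meet h≢g (q∈ h u∈h) q∈θg
      ... | z , z∈h , z∈g with third-end g v≢w v∈g w∈g z∈g
      ...   | inj₁ refl = inj₁ (ends-unique h e u≢v u∈h z∈h u∈e v∈e)
      ...   | inj₂ refl = inj₂ (ends-unique h f u≢w u∈h z∈h u∈f w∈f)

    -- If the stars at both ends of uv are sent into one star of H, the other edges at u
    -- and v are pairwise adjacent, so they are uw and vw for a single vertex w.
    collapse⇒triangle : ∀ {u v} e → u ≢ v → u ∈ e → v ∈ e → Branching u → Branching v →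
                        ∀ {q} → StarImage u q → StarImage v q → TriangleOntoStar
    collapse⇒triangle {u} {v} e u≢v u∈e v∈e u-branching v-branching {q} u-star v-star
      with second-edge u-branching | second-edge v-branching
      where
      second-edge : ∀ {x} → Branching x → ∃ λ f → f ≢ e × x ∈ f
      second-edge (f , f′ , f≢f′ , x∈f , x∈f′) with f ≟ᵉ e
      ... | yes refl = f′ , ≢-sym f≢f′ , x∈f′
      ... | no f≢e   = f , f≢e , x∈f
    ... | f , f≢e , u∈f | g , g≢e , v∈g
      with preimage-meet f≢g (u-star f u∈f) (v-star g v∈g)
      where
      f≢g : f ≢ g
      f≢g refl = f≢e (ends-unique f e u≢v u∈f v∈g u∈e v∈e)
    ... | w , w∈f , w∈g = record
      { u≢v = u≢v ; u≢w = u≢w ; v≢w = v≢w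
      ; u∈e = u∈e ; v∈e = v∈e ; u∈f = u∈f ; w∈f = w∈f ; v∈g = v∈g ; w∈g = w∈g
      ; q∈θ = q∈θ ; all = all }
      where
      f≢g : f ≢ g
      f≢g refl = f≢e (ends-unique f e u≢v u∈f v∈g u∈e v∈e)
      u≢w : u ≢ w
      u≢w refl = g≢e (ends-unique g e u≢v w∈g v∈g u∈e v∈e)
      v≢w : v ≢ w
      v≢w refl = f≢e (ends-unique f e u≢v u∈f w∈f u∈e v∈e)

      InTriangle : Edge G → Set
      InTriangle h = h ≡ e ⊎ h ≡ f ⊎ h ≡ g

      at-u : ∀ h → u ∈ h → InTriangle h
      at-u h u∈h with edges-at-corner e f g u≢v u≢w v≢w u∈e v∈e u∈f w∈f v∈g w∈g
                        u-star (v-star g v∈g) h u∈h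
      ... | inj₁ p = inj₁ p
      ... | inj₂ p = inj₂ (inj₁ p)

      at-v : ∀ h → v ∈ h → InTriangle h
      at-v h v∈h with edges-at-corner e g f (≢-sym u≢v) v≢w u≢w v∈e u∈e v∈g w∈g u∈f w∈f
                        v-star (u-star f u∈f) h v∈h
      ... | inj₁ p = inj₁ p
      ... | inj₂ p = inj₂ (inj₂ p)

      -- The star image at `w` lies on both `θ f` and `θ g`, whose only common vertex is `q`.
      w-star : StarImage w q
      w-star with star w (f , g , f≢g , w∈f , w∈g)
      ... | q′ , q′∈ = subst (StarImage w)
        (shareVertex-unique (θ f) (θ g) (θ-≢ f≢g) (q′∈ f w∈f) (q′∈ g w∈g)
                            (u-star f u∈f) (v-star g v∈g)) q′∈

      at-w : ∀ h → w ∈ h → InTriangle h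
      at-w h w∈h with h ≟ᵉ e
      ... | yes h≡e = inj₁ h≡e
      ... | no h≢e with preimage-meet h≢e (w-star h w∈h) (u-star e u∈e)
      ... | z , z∈h , z∈e with third-end e u≢v u∈e v∈e z∈e
      ... | inj₁ refl = at-u h z∈h
      ... | inj₂ refl = at-v h z∈h

      at : ∀ x h → x ∈ h → InTriangle h
      at = propagate {G = G} connected {λ x → ∀ h → x ∈ h → InTriangle h} step at-u
        where
        step : ∀ {x y} → (∀ h → x ∈ h → InTriangle h) → x ~ y → ∀ h → y ∈ h → InTriangle h
        step x-all x~y with edge-joining {G = G} x~y
        ... | h , x∈h , y∈h with x-all h x∈h
        ... | inj₁ refl with third-end e u≢v u∈e v∈e y∈h
        ...   | inj₁ refl = at-u
        ...   | inj₂ refl = at-v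
        step x-all x~y | h , x∈h , y∈h | inj₂ (inj₁ refl) with third-end f u≢w u∈f w∈f y∈h
        ...   | inj₁ refl = at-u
        ...   | inj₂ refl = at-w
        step x-all x~y | h , x∈h , y∈h | inj₂ (inj₂ refl) with third-end g v≢w v∈g w∈g y∈h
        ...   | inj₁ refl = at-v
        ...   | inj₂ refl = at-w

      all : ∀ h → InTriangle h
      all h = at (end₁ h) h (inj₁ refl)

      q∈θ : ∀ h → q ∈ θ h
      q∈θ h with all h
      ... | inj₁ refl        = u-star e u∈e
      ... | inj₂ (inj₁ refl) = u-star f u∈f
      ... | inj₂ (inj₂ refl) = v-star g v∈g

    -- The search is for an edge with both ends branching and their stars sent into one star.
    -- Without such an edge, the ends of each image can be ordered independently.
    endMap-or-triangle : EndMap ⊎ TriangleOntoStar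
    endMap-or-triangle with any-edge? (λ e →
      branching? (end₁ e) ×-dec branching? (end₂ e) ×-dec
      any? λ q → starImage? (end₁ e) q ×-dec starImage? (end₂ e) q)
    ... | yes (e , b₁ , b₂ , q , s₁ , s₂) =
      inj₂ (collapse⇒triangle e (end₁≢end₂ e) (inj₁ refl) (inj₂ refl) b₁ b₂ s₁ s₂)
    ... | no ¬collapse = inj₁ record
      { ι = ι ; ι∈ = ι∈ ; ι-injective = ι-injective ; ι-agrees = ι-agrees }
      where
      ends : ∀ e → OrderedEnds e
      ends e with branching? (end₁ e) | branching? (end₂ e)
      ... | yes b₁ | yes b₂ with star _ b₁ | star _ b₂
      ... | _ , s₁ | _ , s₂ = record
        { image₁≢image₂ = λ { refl → ¬collapse (e , b₁ , b₂ , _ , s₁ , s₂) }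
        ; image₁∈ = s₁ e (inj₁ refl) ; image₂∈ = s₂ e (inj₂ refl)
        ; star₁ = λ _ → s₁ ; star₂ = λ _ → s₂ }
      ends e | yes b₁ | no ¬b₂ with star _ b₁
      ... | q , s₁ = record
        -- A non-branching end takes whichever end of `θ e` is left over.
        { image₁≢image₂ = ≢-sym (other≢ (θ e) q)
        ; image₁∈ = s₁ e (inj₁ refl) ; image₂∈ = other∈ (θ e) q
        ; star₁ = λ _ → s₁ ; star₂ = λ b₂ → contradiction b₂ ¬b₂ }
      ends e | no ¬b₁ | yes b₂ with star _ b₂
      ... | q , s₂ = record
        { image₁≢image₂ = other≢ (θ e) q
        ; image₁∈ = other∈ (θ e) q ; image₂∈ = s₂ e (inj₂ refl)
        ; star₁ = λ b₁ → contradiction b₁ ¬b₁ ; star₂ = λ _ → s₂ }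
      ends e | no ¬b₁ | no ¬b₂ = record
        { image₁≢image₂ = end₁≢end₂ (θ e)
        ; image₁∈ = inj₁ refl ; image₂∈ = inj₂ refl
        ; star₁ = λ b₁ → contradiction b₁ ¬b₁ ; star₂ = λ b₂ → contradiction b₂ ¬b₂ }

      module Ends e = OrderedEnds (ends e)

      ι : Edge G → Fin n → Fin m
      ι e v with v ≟ end₁ e
      ... | yes _ = Ends.image₁ e
      ... | no _  = Ends.image₂ e

      ι∈ : ∀ e {v} → v ∈ e → ι e v ∈ θ e
      ι∈ e {v} _ with v ≟ end₁ e
      ... | yes _ = Ends.image₁∈ e
      ... | no _  = Ends.image₂∈ e

      ι-injective : ∀ e {u v} → u ≢ v → u ∈ e → v ∈ e → ι e u ≢ ι e v
      ι-injective e {u} {v} u≢v u∈e v∈e with u ≟ end₁ e | v ≟ end₁ e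
      ... | yes p | yes q = contradiction (trans p (sym q)) u≢v
      ... | yes _ | no _  = Ends.image₁≢image₂ e
      ... | no _  | yes _ = ≢-sym (Ends.image₁≢image₂ e)
      ... | no p  | no q with u∈e | v∈e
      ...   | inj₁ u≡ | _       = contradiction u≡ p
      ...   | inj₂ _  | inj₁ v≡ = contradiction v≡ q
      ...   | inj₂ u≡ | inj₂ v≡ = contradiction (trans u≡ (sym v≡)) u≢v

      ι-star : ∀ e {v} → v ∈ e → Branching v → StarImage v (ι e v)
      ι-star e {v} v∈e b with v ≟ end₁ e
      ... | yes refl = Ends.star₁ e b
      ... | no p with v∈e
      ...   | inj₁ v≡   = contradiction v≡ p
      ...   | inj₂ refl = Ends.star₂ e b

      ι-agrees : ∀ {e f v} → e ≢ f → v ∈ e → v ∈ f → ι e v ≡ ι f v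
      ι-agrees {e} {f} e≢f v∈e v∈f = shareVertex-unique (θ e) (θ f) (θ-≢ e≢f)
        (ι∈ e v∈e) (ι-star e v∈e (e , f , e≢f , v∈e , v∈f) f v∈f)
        (ι-star f v∈f (e , f , e≢f , v∈e , v∈f) e v∈e) (ι∈ f v∈f)


  endMap-or-triangle-or-exception : EndMap ⊎ TriangleOntoStar ⊎ WhitneyException G
  endMap-or-triangle-or-exception
    with any? (λ v → branching? v ×-dec ¬? (any? (starImage? v)))
  ... | no ¬v = star-cases
    where
    star-cases : EndMap ⊎ TriangleOntoStar ⊎ WhitneyException G
    star-cases with endMap-or-triangle (λ v b →
      decidable-stable (any? (starImage? v)) λ ¬star → ¬v (v , b , ¬star))
    ... | inj₁ m = inj₁ m
    ... | inj₂ t = inj₂ (inj₁ t)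
  ... | yes (v , b , ¬star) with starImage-or-exception v b
  ...   | inj₁ s = contradiction s ¬star
  ...   | inj₂ x = inj₂ (inj₂ x)

-- Root orientations exist

module _ {n m : ℕ} {W : Set} {G : Graph (Fin n)} (Y : MixedGraph W) (φ : Root G (Γ Y))
  (connected : Connected G) (X₀ : MixedGraph (Fin m)) (ψ : L (Γ X₀) ≅ Γ Y)
  (ψ-arcs : PreservesArcs (Lγ X₀) Y ψ) where

  open Edge
  private
    module Y = MixedGraph Y
    module φ = _≅_ φ
    module ψ = _≅_ ψ
    module X₀ = MixedGraph X₀
    module φ↔ = Inverse φ.bijection
    module ψ↔ = Inverse ψ.bijection

    θ : Edge G → Edge (Γ X₀)
    θ e = ψ.from (φ.to e)

    ψθ : ∀ e → ψ.to (θ e) ≡ φ.to e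
    ψθ e = ψ↔.strictlyInverseˡ (φ.to e)

    θ-injective : ∀ {e f} → θ e ≡ θ f → e ≡ f
    θ-injective {e} {f} p = trans (sym (φ↔.strictlyInverseʳ e)) (trans
      (cong φ.from (trans (sym (ψθ e)) (trans (cong ψ.to p) (ψθ f)))) (φ↔.strictlyInverseʳ f))

    θ-preserves : ∀ e f → Graph._~_ (L G) e f ⇔ Graph._~_ (L (Γ X₀)) (θ e) (θ f)
    θ-preserves e f = ⇔.trans (φ.preserves e f)
      (subst₂ (λ a b → Graph._~_ (Γ Y) a b ⇔ Graph._~_ (L (Γ X₀)) (θ e) (θ f))
        (ψθ e) (ψθ f) (⇔.sym (ψ.preserves (θ e) (θ f))))

    module θ = LineGraphEmbedding {H = Γ X₀} connected θ θ-injective θ-preserves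

    y₀ : Phases (Γ X₀)
    y₀ = phase X₀.orientation

    arc⇔ : ∀ {e f q} → e ≢ f → q ∈ θ e → q ∈ θ f →
           Y.Arc (φ.to e) (φ.to f) ⇔ y₀ (θ f) q ≡ 1F ⊕ y₀ (θ e) q
    arc⇔ {e} {f} e≢f q∈e q∈f = ⇔.trans
      (subst₂ (λ a b → Y.Arc a b ⇔ LArc X₀ (θ e) (θ f)) (ψθ e) (ψθ f) (⇔.sym (ψ-arcs (θ e) (θ f))))
      (LArc⇔ X₀.orientation (θ.θ-≢ e≢f) q∈e q∈f)

    pullback : θ.EndMap → RootOrientation Y φ
    pullback ends = realisation Y φ (λ e v → y₀ (θ e) (ι e v))
      (λ e u≢v u∈e v∈e → phase-alternating X₀.orientation (θ e)
        (ι-injective e u≢v u∈e v∈e) (ι∈ e u∈e) (ι∈ e v∈e))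
      (λ {e} {f} {v} e≢f v∈e v∈f →
        subst (λ q → Y.Arc (φ.to e) (φ.to f) ⇔ y₀ (θ f) q ≡ 1F ⊕ y₀ (θ e) (ι e v))
          (ι-agrees e≢f v∈e v∈f)
          (arc⇔ e≢f (ι∈ e v∈e) (subst (_∈ θ f) (sym (ι-agrees e≢f v∈e v∈f)) (ι∈ f v∈f))))
      where open θ.EndMap ends

    -- With T x the phase at q of the image of the edge opposite to the corner x, the
    -- phase of ux at x is T x - T u.  So at a common corner x the phases of wx and ux
    -- differ by T u - T w, which is the difference of the images of wx and ux at q.
    triangleSolution : θ.TriangleOntoStar → RootOrientation Y φ
    triangleSolution t = realisation Y φ (λ k x → T x ⊖ T (other k x)) alternating realises
      where
      open θ.TriangleOntoStar t
      z : Edge G → Fin 3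
      z h = y₀ (θ h) q

      T : Fin n → Fin 3
      T x with x ≟ u | x ≟ v
      ... | yes _ | _     = z g
      ... | no _  | yes _ = z f
      -- This default is meant for `w`; in `T-opposite` it is the edge `k` at `x` that shows `x` to
      -- be `w`.
      ... | no _  | no _  = z e

      T-opposite : ∀ {x} k h → x ∈ k → ¬ x ∈ h → T x ≡ z h
      T-opposite {x} k h x∈k x∉h with x ≟ u | x ≟ v | all h
      ... | yes refl | _        | inj₁ refl        = contradiction u∈e x∉h
      ... | yes refl | _        | inj₂ (inj₁ refl) = contradiction u∈f x∉h
      ... | yes _    | _        | inj₂ (inj₂ refl) = refl
      ... | no _     | yes refl | inj₁ refl        = contradiction v∈e x∉h
      ... | no _     | yes _    | inj₂ (inj₁ refl) = refl
      ... | no _     | yes refl | inj₂ (inj₂ refl) = contradiction v∈g x∉h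
      ... | no _     | no _     | inj₁ refl        = refl
      ... | no x≢u   | no x≢v   | inj₂ h≡ = contradiction (w∈fg h≡) (subst (λ i → ¬ i ∈ h) x≡w x∉h)
        where
        w∈fg : h ≡ f ⊎ h ≡ g → w ∈ h
        w∈fg (inj₁ refl) = w∈f
        w∈fg (inj₂ refl) = w∈g
        x≡w : x ≡ w
        x≡w with all k
        ... | inj₁ refl with third-end e u≢v u∈e v∈e x∈k
        ...   | inj₁ p = contradiction p x≢u
        ...   | inj₂ p = contradiction p x≢v
        x≡w | inj₂ (inj₁ refl) with third-end f u≢w u∈f w∈f x∈k
        ...   | inj₁ p = contradiction p x≢u
        ...   | inj₂ p = p
        x≡w | inj₂ (inj₂ refl) with third-end g v≢w v∈g w∈g x∈k
        ...   | inj₁ p = contradiction p x≢v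
        ...   | inj₂ p = p

      alternating : Alternating (λ k x → T x ⊖ T (other k x))
      alternating k {a} {b} a≢b a∈k b∈k = trans
        (cong (λ c → T a ⊖ T c) (sym (other-unique k (≢-sym a≢b) b∈k a∈k)))
        (trans (⊝-⊖ (T a) (T b)) (cong (λ c → ⊝ (T b ⊖ T c)) (other-unique k a≢b a∈k b∈k)))

      realises : Realises Y φ (λ k x → T x ⊖ T (other k x))
      realises {h} {k} {x} h≢k x∈h x∈k
        -- The far end of `k` is not on `h`, so `h` is the side opposite to it, and likewise with
        -- `h` and `k` exchanged. The phases of `k` and `h` at `x` become `T x ⊖ z h` and
        -- `T x ⊖ z k`.
        rewrite T-opposite k h (other∈ k x) (λ o∈h → h≢k (ends-unique h k (other≢ k x)
                  o∈h x∈h (other∈ k x) x∈k))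
              | T-opposite h k (other∈ h x) (λ o∈k → h≢k (ends-unique h k (other≢ h x)
                  (other∈ h x) x∈h o∈k x∈k)) =
        ⇔.trans (arc⇔ h≢k (q∈θ h) (q∈θ k)) (suc-⊖ _ _ (T x))

  rootOrientation-exists : (WhitneyException G → RootOrientation Y φ) → RootOrientation Y φ
  rootOrientation-exists exceptional with θ.endMap-or-triangle-or-exception
  ... | inj₁ ends     = pullback ends
  ... | inj₂ (inj₁ t) = triangleSolution t
  ... | inj₂ (inj₂ x) = exceptional x

theorem15 : {W : Set} (Y : MixedGraph W) → W → IsγLineGraph Y →
    {n : ℕ} (G : Graph (Fin n)) (φ : Root G (Γ Y)) → Connected G →
    (WhitneyException G → RootOrientation Y φ) →
    (Bipartite G → HasExactly 3 (RootOrientations Y φ)) ×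
    (¬ Bipartite G → HasExactly 1 (RootOrientations Y φ))
theorem15 Y w (_ , X₀ , ψ , ψ-arcs) G φ connected exceptional =
  -- The vertex `w` of `Y` corresponds to an edge of `G`, the base edge at which the count reads its
  -- coordinate.
  count Y φ connected (_≅_.from φ w)
    (rootOrientation-exists Y φ connected X₀ ψ ψ-arcs exceptional)
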